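{- Let $n,b$ be integers with $1<n<b$, let $C$ be an $(n,b)$-permutiple class with graph $G_C$, and suppose that the state $n-1$ is a vertex of $\Gamma_C$. Then the symmetric closure $\widehat{C}$ of $C$ is a symmetric class. Moreover, the following are equivalent: (1) $C$ is a symmetric class; (2) $C=\widehat{C}$; (3) $\Gamma_C$ is a symmetric subgraph of the $(n,b)$-Hoey-Sloane graph (i.e. $\overline{\Gamma}_C=\Gamma_C$); (4) $G_C$ is a symmetric graph (i.e. $\overline{G}_C=G_C$).
   Context: For digits $0\le d_j<b$, $(d_k,\ldots,d_0)_b=\sum_j d_jb^j$ (leading zeros allowed). For a permutation $\sigma$ of $\{0,\ldots,k\}$, $(d_k,\ldots,d_0)_b$ is an $(n,b,\sigma)$-permutiple if $(d_k,\ldots,d_0)_b=n\cdot(d_{\sigma(k)},\ldots,d_{\sigma(0)})_b$; an $(n,b)$-permutiple if this holds for some $\sigma$. Its graph $G_p$ is the directed graph on vertex set $\{0,\ldots,b-1\}$ with edge set $\{(d_j,d_{\sigma(j)})\mid 0\le j\le k\}$. For a directed graph $G$ on $\{0,\ldots,b-1\}$ let $\mathrm{Cl}(G)$ be the set of all $(n,b)$-permutiples $q$ with $G_q$ a subgraph of $G$. The class of a permutiple $p$ is $C=\mathrm{Cl}(G_p)$, with graph $G_C=G_p$. For a digit $d$ put $\overline d=b-1-d$, for a state $c\in\{0,\dots,n-1\}$ put $\overline c=n-1-c$. The reflection $\overline G$ of a graph $G$ on $\{0,\ldots,b-1\}$ has edges $(\overline d_1,\overline d_2)$ for edges $(d_1,d_2)$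 of $G$. With $\lambda(x)$ the least non-negative residue mod $b$, the mother graph $M$ has vertex set $\{0,\ldots,b-1\}$ and edges the pairs $(d_1,d_2)$ with $\lambda(d_1+(b-n)d_2)\le n-1$. The Hoey-Sloane graph $\Gamma$ is the edge-labelled directed graph on states $\{0,\ldots,n-1\}$ where $(c_1,c_2)$ is an edge labelled by every edge $(d_1,d_2)$ of $M$ with $nd_2-d_1+c_1=bc_2$ (an edge exists iff such a label exists). The cycle image of a directed cycle $C_0$ of $M$ is the edge-labelled subgraph of $\Gamma$ with edges the $(c_1,c_2)$ for which $\{(d_1,d_2)\in C_0\mid nd_2-d_1+c_1=bc_2\}\neq\emptyset$, labelled by this set, and vertices their endpoints. $\Gamma_C$ is the union of the cycle images of the directed cycles contained in $G_C$. The reflection of an edge-labelled subgraph of $\Gamma$ replaces each vertex $c$ by $\overline c$, each edge $(c_1,c_2)$ by $(\overline c_1,\overline c_2)$, and each label $(d_1,d_2)$ by $(\overline d_1,\overline d_2)$. When $n-1$ is a vertex of $\Gamma_C$, there is an $(n,b)$-permutiple with graph $\overline{G}_C$, and the reflection of $C$ is the class $\overline{C}=\mathrm{Cl}(\overline{G}_C)$ (with graph $\overline{G}_C$); $C$ is a symmetric class if $C=\overline{C}$. The symmetric closure of $C$ is the permutiple class $\widehat{C}$ with graph $G_C\cup\overline{G}_C$, i.e. $\widehat C=\mathrm{Cl}(G_C\cup\overline{G}_C)$; it is a symmetric class if it equals its reflection, the class with graph $\overline{G_C\cup\overline{G}_C}$. -}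

module Defs where

open import Level using (0ℓ)
open import Algebra.Properties.CommutativeMonoid.Sum using (sum)
open import Data.Nat using (ℕ; suc; _+_; _*_; _∸_; _^_; _≤_)
open import Data.Nat.DivMod using (_%_; _mod_)
open import Data.Nat.Properties using (+-0-commutativeMonoid)
open import Data.Fin using (Fin; toℕ; opposite)
open import Data.Fin.Permutation using (Permutation′; _⟨$⟩ʳ_)
open import Data.Fin.Properties using (nonZeroIndex)
open import Data.Product using (Σ-syntax; ∃-syntax; _×_; _,_)
open import Data.Sum using (_⊎_)
open import Data.Unit using (⊤)
open import Data.Vec.Functional using (Vector; rearrange)
open import Function.Definitions using (Injective)
open import Relation.Binary.Core using (Rel; _⇒_; _⇔_)
open import Relation.Binary.PropositionalEquality using (_≡_)
open import Relation.Unary using (Pred; _≐_)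

private
  variable
    n b m : ℕ

-- Little-endian: index j holds the coefficient of b ^ j.
value : Vector (Fin b) m → ℕ
value {b} d = sum +-0-commutativeMonoid λ j → toℕ (d j) * b ^ toℕ j

IsPermutiple : ℕ → Vector (Fin b) m → Permutation′ m → Set
IsPermutiple n d σ = value d ≡ n * value (rearrange (σ ⟨$⟩ʳ_) d)

Graph : ℕ → Set₁
Graph b = Rel (Fin b) 0ℓ

permutipleGraph : Vector (Fin b) m → Permutation′ m → Graph b
permutipleGraph d σ d₁ d₂ = ∃[ j ] d₁ ≡ d j × d₂ ≡ d (σ ⟨$⟩ʳ j)

-- Digit strings (d_k, …, d_0), of unspecified length but with at least one
-- digit.  Strings that differ only by leading zeros are different.
DigitString : ℕ → Set
DigitString b = Σ[ k ∈ ℕ ] Vector (Fin b) (suc k)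

-- The choice of σ is immaterial: for n ≠ 0 the digits d_σ(j) are those of
-- value d / n, so all σ making d a permutiple give the same graph.
Cl : ℕ → Graph b → Pred (DigitString b) 0ℓ
Cl n G (k , d) =
  Σ[ σ ∈ Permutation′ (suc k) ] IsPermutiple n d σ × permutipleGraph d σ ⇒ G

-- C is the class of some permutiple p, and G is the graph of that p.
record IsPermutipleClass (n : ℕ) (C : Pred (DigitString b) 0ℓ)
                         (G : Graph b) : Set where
  field
    {k}          : ℕ
    digits       : Vector (Fin b) (suc k)
    σ            : Permutation′ (suc k)
    isPermutiple : IsPermutiple n digits σ
    graph        : permutipleGraph digits σ ⇔ G
    members      : C ≐ Cl n (permutipleGraph digits σ)

-- opposite d is b - 1 - d.  As it is an involution, the image of the edge
-- set under it is the same as the preimage.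
reflect : Graph b → Graph b
reflect G d₁ d₂ = G (opposite d₁) (opposite d₂)

mother : ∀ n b → Graph b
mother n b d₁ d₂ =
  _%_ (toℕ d₁ + (b ∸ n) * toℕ d₂) b {{nonZeroIndex d₁}} ≤ n ∸ 1

record LabelledGraph (n b : ℕ) : Set₁ where
  field
    vertex : Pred (Fin n) 0ℓ
    edge   : Rel (Fin n) 0ℓ
    label  : Fin n → Fin n → Rel (Fin b) 0ℓ

open LabelledGraph public

infix 4 _⊑_ _≋_

_⊑_ : LabelledGraph n b → LabelledGraph n b → Set
H ⊑ K = (∀ {c} → vertex H c → vertex K c)
      × (edge H ⇒ edge K)
      × (∀ {c₁ c₂} → label H c₁ c₂ ⇒ label K c₁ c₂)

_≋_ : LabelledGraph n b → LabelledGraph n b → Set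
H ≋ K = H ⊑ K × K ⊑ H

reflectLabelled : LabelledGraph n b → LabelledGraph n b
reflectLabelled H .vertex c     = vertex H (opposite c)
reflectLabelled H .edge   c₁ c₂ = edge H (opposite c₁) (opposite c₂)
reflectLabelled H .label  c₁ c₂ = reflect (label H (opposite c₁) (opposite c₂))

-- The equation n d₂ - d₁ + c₁ = b c₂, with d₁ moved to the right.
Transition : Fin n → Fin n → Rel (Fin b) 0ℓ
Transition {n} {b} c₁ c₂ d₁ d₂ =
  n * toℕ d₂ + toℕ c₁ ≡ b * toℕ c₂ + toℕ d₁

-- The edges that carry a label.
Labelled : (Fin n → Fin n → Rel (Fin b) 0ℓ) → Rel (Fin n) 0ℓ
Labelled L c₁ c₂ = ∃[ d₁ ] ∃[ d₂ ] L c₁ c₂ d₁ d₂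

hoeySloane : ∀ n b → LabelledGraph n b
hoeySloane n b = record
  { vertex = λ _ → ⊤
  ; edge   = Labelled L
  ; label  = L
  }
  where
  L : Fin n → Fin n → Rel (Fin b) 0ℓ
  L c₁ c₂ d₁ d₂ = mother n b d₁ d₂ × Transition c₁ c₂ d₁ d₂

cyclicSuc : Fin (suc m) → Fin (suc m)
cyclicSuc {m} i = suc (toℕ i) mod suc m

-- Cycles do not repeat vertices; a loop is a cycle of length 1.
record DirectedCycle (G : Graph b) : Set where
  field
    {ℓ}      : ℕ
    node     : Fin (suc ℓ) → Fin b
    distinct : Injective _≡_ _≡_ node
    step     : ∀ i → G (node i) (node (cyclicSuc i))

cycleEdges : {G : Graph b} → DirectedCycle G → Graph b
cycleEdges Z d₁ d₂ = ∃[ i ] d₁ ≡ node i × d₂ ≡ node (cyclicSuc i)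
  where open DirectedCycle Z

cycleImage : DirectedCycle (mother n b) → LabelledGraph n b
cycleImage {n} {b} Z = record
  { vertex = λ c → ∃[ c′ ] (Labelled L c c′ ⊎ Labelled L c′ c)
  ; edge   = Labelled L
  ; label  = L
  }
  where
  L : Fin n → Fin n → Rel (Fin b) 0ℓ
  L c₁ c₂ d₁ d₂ = cycleEdges Z d₁ d₂ × Transition c₁ c₂ d₁ d₂

-- Γ_C, as a function of the graph G of the class C.
Γ : ∀ n → Graph b → LabelledGraph n b
Γ {b} n G .vertex c           =
  Σ[ Z ∈ DirectedCycle (mother n b) ] cycleEdges Z ⇒ G × vertex (cycleImage Z) c
Γ {b} n G .edge   c₁ c₂       =
  Σ[ Z ∈ DirectedCycle (mother n b) ] cycleEdges Z ⇒ G × edge (cycleImage Z) c₁ c₂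
Γ {b} n G .label  c₁ c₂ d₁ d₂ =
  Σ[ Z ∈ DirectedCycle (mother n b) ]
    cycleEdges Z ⇒ G × label (cycleImage Z) c₁ c₂ d₁ d₂

HasTopState : LabelledGraph n b → Set
HasTopState {n} H = Σ[ c ∈ Fin n ] toℕ c ≡ n ∸ 1 × vertex H c

-- The reflection of a class is defined only when n - 1 is a state of Γ_C;
-- this is why topState is part of the definition.
record IsSymmetricClass (n : ℕ) (C : Pred (DigitString b) 0ℓ)
                        (G : Graph b) : Set where
  field
    isClass      : IsPermutipleClass n C G
    topState     : HasTopState (Γ n G)
    ≐-reflection : C ≐ Cl n (reflect G)

IsSymmetricGraph : Graph b → Set
IsSymmetricGraph G = reflect G ⇔ G

IsSymmetricSubgraph : LabelledGraph n b → Set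
IsSymmetricSubgraph {n} {b} H = H ⊑ hoeySloane n b × reflectLabelled H ≋ H

{-# OPTIONS --safe #-}
-- A permutiple is a closed walk at the state 0 of the Hoey-Sloane graph whose
-- steps are labelled by its edges.  If the walk W passes through n - 1, cut it
-- there as W = A·B.  The reflection W̄ is a closed walk at n - 1, so A·W̄·B is
-- again a closed walk at 0; it is a permutiple with graph G ∪ Ḡ.  Since a digit
-- string determines its graph, C ⊆ Cl H forces G ⊆ H, and every edge of G lies
-- on a cycle of G (follow an orbit of σ), so the labels of Γ_C are the edges
-- of G.  Hence each of the four conditions amounts to Ḡ ⊆ G.
module Submission where

open import Defs
open import Level using (0ℓ)
open import Data.Nat using (ℕ; _<_)
open import Data.Product using (_×_)
open import Function.Bundles using () renaming (_⇔_ to _iff_)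
open import Relation.Binary.Construct.Union using (_∪_)
open import Relation.Unary using (Pred; _≐_)

open import Data.Fin using (Fin; zero; suc; toℕ; fromℕ; fromℕ<; inject₁; opposite; _↑ˡ_; _↑ʳ_)
open import Data.Fin.Permutation using (Permutation′; _⟨$⟩ʳ_)
open import Data.Fin.Properties
  using (toℕ<n; toℕ-injective; toℕ-fromℕ; toℕ-fromℕ<; toℕ-inject₁; suc-injective; any?;
         opposite-prop; opposite-involutive; pigeonhole; splitAt-↑ˡ; splitAt-↑ʳ; +↔⊎; _≟_)
open import Data.Fin.Relation.Unary.Top using (view; ‵fromℕ; ‵inject₁)
open import Data.Nat using (zero; suc; _+_; _*_; _∸_; _^_; _≤_; s≤s; s≤s⁻¹)
open import Data.Nat.DivMod
  using (_/_; _%_; m%n<n; n%n≡0; m<n⇒m%n≡m; [m+kn]%n≡m%n; m≡m%n+[m/n]*n; m<n*o⇒m/o<n)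
open import Data.Nat.GeneralisedArithmetic using (iterate)
open import Data.Nat.Properties
  using (+-*-semiring; *-comm; +-comm; +-identityʳ; *-zeroʳ; *-identityʳ; +-cancelˡ-≡; *-cancelˡ-≡;
         m+[n∸m]≡n; m≤n⇒∃[o]m+o≡n; +-suc; +-mono-≤-<; *-monoʳ-≤; <-trans; <-≤-trans;
         n<1+n; <⇒≤; ≤-refl; ^-distribˡ-+-*; module ≤-Reasoning)
open import Algebra.Properties.Semiring.Sum +-*-semiring using (sum; sum-cong-≗; *-distribˡ-sum)
open import Data.Nat.Tactic.RingSolver using (solve-∀)
open import Data.Product using (Σ-syntax; ∃-syntax; _,_; proj₁; proj₂)
open import Data.Sum using (_⊎_; inj₁; inj₂; [_,_])
open import Data.Sum.Function.Propositional using (_⊎-↔_)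
open import Data.Unit using (tt)
open import Data.Vec.Functional using (Vector; head; tail; _∷_)
open import Function.Base using (_∘_; id)
open import Function.Bundles using (_↔_; mk↔ₛ′; mk⇔; Inverse; Injection)
open import Function.Properties.Inverse using (↔⇒↣)
open import Function.Construct.Composition using (_↔-∘_)
open import Function.Construct.Identity using (↔-id)
open import Function.Construct.Symmetry using (↔-sym)
open import Relation.Binary.Core using (_⇒_; _⇔_)
open import Relation.Binary.PropositionalEquality
  using (_≡_; _≗_; refl; sym; trans; cong; cong₂; subst; subst₂; module ≡-Reasoning)
open import Relation.Nullary using (yes; no; contradiction)

private
  variable
    n b K : ℕ
    G H : Graph b

-- Division with remainder and single transitions

euclid-unique : ∀ {b r r′ q q′} → r < b → r′ < b →
                r + b * q ≡ r′ + b * q′ → r ≡ r′ × q ≡ q′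
euclid-unique {suc b} {r} {r′} {q} {q′} r<b r′<b eq = r≡r′ , q≡q′
  where
  mod-b : ∀ {r} q → r < suc b → (r + suc b * q) % suc b ≡ r
  mod-b {r} q r<b = begin
    (r + suc b * q) % suc b ≡⟨ cong (λ t → (r + t) % suc b) (*-comm (suc b) q) ⟩
    (r + q * suc b) % suc b ≡⟨ [m+kn]%n≡m%n r q (suc b) ⟩
    r % suc b               ≡⟨ m<n⇒m%n≡m r<b ⟩
    r                       ∎
    where open ≡-Reasoning
  r≡r′ : r ≡ r′
  r≡r′ = trans (sym (mod-b q r<b)) (trans (cong (_% suc b) eq) (mod-b q′ r′<b))
  q≡q′ : q ≡ q′
  q≡q′ = *-cancelˡ-≡ q q′ (suc b)
    (+-cancelˡ-≡ r _ _ (trans eq (cong (_+ suc b * q′) (sym r≡r′))))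

-- Eliminating the digits gives `c₁ + b * c₂′ ≡ c₁′ + b * c₂`. States lie below `b`, so division
-- with remainder separates the two parts: a label determines the edge that carries it.
transition-unique : n ≤ b → {c₁ c₂ c₁′ c₂′ : Fin n} {d₁ d₂ : Fin b} →
  Transition c₁ c₂ d₁ d₂ → Transition c₁′ c₂′ d₁ d₂ → c₁ ≡ c₁′ × c₂ ≡ c₂′
transition-unique {n} {b} n≤b {c₁} {c₂} {c₁′} {c₂′} {d₁} {d₂} t t′ =
  toℕ-injective (proj₁ states≡) , sym (toℕ-injective (proj₂ states≡))
  where
  open ≡-Reasoning
  shuffle₁ : ∀ p c q → p + (c + q) ≡ (p + c) + q
  shuffle₁ = solve-∀
  shuffle₂ : ∀ q d q′ → (q + d) + q′ ≡ (q′ + d) + q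
  shuffle₂ = solve-∀
  states≡ : toℕ c₁ ≡ toℕ c₁′ × toℕ c₂′ ≡ toℕ c₂
  states≡ = euclid-unique (<-≤-trans (toℕ<n c₁) n≤b) (<-≤-trans (toℕ<n c₁′) n≤b)
    (+-cancelˡ-≡ (n * toℕ d₂) _ _ (begin
      n * toℕ d₂ + (toℕ c₁ + b * toℕ c₂′)  ≡⟨ shuffle₁ (n * toℕ d₂) _ _ ⟩
      n * toℕ d₂ + toℕ c₁ + b * toℕ c₂′    ≡⟨ cong (_+ b * toℕ c₂′) t ⟩
      b * toℕ c₂ + toℕ d₁ + b * toℕ c₂′    ≡⟨ shuffle₂ (b * toℕ c₂) _ _ ⟩
      b * toℕ c₂′ + toℕ d₁ + b * toℕ c₂    ≡⟨ cong (_+ b * toℕ c₂) t′ ⟨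
      n * toℕ d₂ + toℕ c₁′ + b * toℕ c₂    ≡⟨ shuffle₁ (n * toℕ d₂) _ _ ⟨
      n * toℕ d₂ + (toℕ c₁′ + b * toℕ c₂)  ∎))

-- Modulo `b`, `d₁ + (b - n) d₂` is `d₁ - n d₂`, which the transition makes congruent to `c₁`. The
-- residue is thus the state `c₁` itself, at most `n - 1`.
transition⇒mother : n < b → {c₁ c₂ : Fin n} {d₁ d₂ : Fin b} →
                    Transition c₁ c₂ d₁ d₂ → mother n b d₁ d₂
transition⇒mother {suc n} {b@(suc _)} n<b {c₁} {c₂} {d₁} {d₂} t =
  subst (_≤ n) (sym residue) (s≤s⁻¹ (toℕ<n c₁))
  where
  open ≡-Reasoning
  x = toℕ d₁ + (b ∸ suc n) * toℕ d₂
  shuffle₁ : ∀ d m q → d + m + q ≡ m + (q + d)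
  shuffle₁ = solve-∀
  shuffle₂ : ∀ e n d c → e * d + (n * d + c) ≡ c + d * (n + e)
  shuffle₂ = solve-∀
  shifted : x + toℕ c₂ * b ≡ toℕ c₁ + toℕ d₂ * b
  shifted = begin
    x + toℕ c₂ * b                                          ≡⟨ cong (x +_) (*-comm (toℕ c₂) b) ⟩
    x + b * toℕ c₂                                          ≡⟨ shuffle₁ (toℕ d₁) _ _ ⟩
    (b ∸ suc n) * toℕ d₂ + (b * toℕ c₂ + toℕ d₁)            ≡⟨ cong ((b ∸ suc n) * toℕ d₂ +_) t ⟨
    (b ∸ suc n) * toℕ d₂ + (suc n * toℕ d₂ + toℕ c₁)        ≡⟨ shuffle₂ (b ∸ suc n) (suc n) (toℕ d₂) _ ⟩
    toℕ c₁ + toℕ d₂ * (suc n + (b ∸ suc n))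
      ≡⟨ cong (λ s → toℕ c₁ + toℕ d₂ * s) (m+[n∸m]≡n (<⇒≤ n<b)) ⟩
    toℕ c₁ + toℕ d₂ * b                                     ∎
  residue : x % b ≡ toℕ c₁
  residue = begin
    x % b                       ≡⟨ [m+kn]%n≡m%n x (toℕ c₂) b ⟨
    (x + toℕ c₂ * b) % b        ≡⟨ cong (_% b) shifted ⟩
    (toℕ c₁ + toℕ d₂ * b) % b   ≡⟨ [m+kn]%n≡m%n (toℕ c₁) (toℕ d₂) b ⟩
    toℕ c₁ % b                  ≡⟨ m<n⇒m%n≡m (<-trans (toℕ<n c₁) n<b) ⟩
    toℕ c₁                      ∎

-- Reflection

opposite-sum : (i : Fin b) → suc (toℕ i + toℕ (opposite i)) ≡ b
opposite-sum i = trans (cong (λ t → suc (toℕ i + t)) (opposite-prop i)) (m+[n∸m]≡n (toℕ<n i))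

-- Covers both a single transition (B = b) and a whole walk (B = b ^ K).
complement-balance : ∀ {n B v v̄ v′ v̄′ c c̄ c′ c̄′} →
  suc (v + v̄) ≡ B → suc (v′ + v̄′) ≡ B → suc (c + c̄) ≡ n → suc (c′ + c̄′) ≡ n →
  n * v′ + c ≡ B * c′ + v → n * v̄′ + c̄ ≡ B * c̄′ + v̄
complement-balance {n} {B} {v} {v̄} {v′} {v̄′} {c} {c̄} {c′} {c̄′} ev ev′ ec ec′ eq =
  +-cancelˡ-≡ (suc (n * v′ + c)) _ _ (begin
    suc (n * v′ + c) + (n * v̄′ + c̄)      ≡⟨ shuffle n v′ v̄′ c c̄ ⟩
    n * (v′ + v̄′) + suc (c + c̄)          ≡⟨ cong (n * (v′ + v̄′) +_) ec ⟩
    n * (v′ + v̄′) + n                    ≡⟨ fold-suc n (v′ + v̄′) ⟩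
    n * suc (v′ + v̄′)                    ≡⟨ cong (n *_) ev′ ⟩
    n * B                                ≡⟨ *-comm n B ⟩
    B * n                                ≡⟨ cong (B *_) ec′ ⟨
    B * suc (c′ + c̄′)                    ≡⟨ fold-suc B (c′ + c̄′) ⟨
    B * (c′ + c̄′) + B                    ≡⟨ cong (B * (c′ + c̄′) +_) ev ⟨
    B * (c′ + c̄′) + suc (v + v̄)          ≡⟨ shuffle B c′ c̄′ v v̄ ⟨
    suc (B * c′ + v) + (B * c̄′ + v̄)      ≡⟨ cong (λ t → suc t + (B * c̄′ + v̄)) eq ⟨
    suc (n * v′ + c) + (B * c̄′ + v̄)      ∎)
  where
  open ≡-Reasoning
  shuffle : ∀ n v v̄ c c̄ → suc (n * v + c) + (n * v̄ + c̄) ≡ n * (v + v̄) + suc (c + c̄)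
  shuffle = solve-∀
  fold-suc : ∀ n v → n * v + n ≡ n * suc v
  fold-suc = solve-∀

transition-reflect : (c₁ c₂ : Fin n) (d₁ d₂ : Fin b) → Transition c₁ c₂ d₁ d₂ →
  Transition (opposite c₁) (opposite c₂) (opposite d₁) (opposite d₂)
transition-reflect c₁ c₂ d₁ d₂ =
  complement-balance (opposite-sum d₁) (opposite-sum d₂) (opposite-sum c₁) (opposite-sum c₂)

opposite-flip : {i j : Fin b} → opposite i ≡ j → i ≡ opposite j
opposite-flip {i = i} eq = trans (sym (opposite-involutive i)) (cong opposite eq)

reflect-reflect : (G : Graph b) → reflect (reflect G) ⇒ G
reflect-reflect G {x} {y} = subst₂ G (opposite-involutive x) (opposite-involutive y)

-- Values of digit strings

value-cong : {f g : Vector (Fin b) K} → f ≗ g → value f ≡ value g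
value-cong {b} f≗g = sum-cong-≗ λ j → cong (λ d → toℕ d * b ^ toℕ j) (f≗g j)

value-suc : (f : Vector (Fin b) (suc K)) → value f ≡ toℕ (head f) + b * value (tail f)
value-suc {b} {K} f = cong₂ _+_ (*-identityʳ _) (begin
  sum (λ j → toℕ (f (suc j)) * (b * b ^ toℕ j))   ≡⟨ sum-cong-≗ (λ j → shuffle (toℕ (f (suc j))) b _) ⟩
  sum (λ j → b * (toℕ (f (suc j)) * b ^ toℕ j))   ≡⟨ *-distribˡ-sum b (λ j → toℕ (f (suc j)) * b ^ toℕ j) ⟨
  b * value (tail f)                              ∎)
  where
  open ≡-Reasoning
  shuffle : ∀ d b p → d * (b * p) ≡ b * (d * p)
  shuffle = solve-∀

value-split : ∀ m {l} (f : Vector (Fin b) (m + l)) →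
              value f ≡ value (f ∘ (_↑ˡ l)) + b ^ m * value (f ∘ (m ↑ʳ_))
value-split zero f = sym (+-identityʳ _)
value-split {b} (suc m) {l} f = begin
  value f                              ≡⟨ value-suc f ⟩
  x + b * value (tail f)               ≡⟨ cong (λ t → x + b * t) (value-split m (tail f)) ⟩
  x + b * (v + b ^ m * w)              ≡⟨ shuffle x b v (b ^ m) w ⟩
  x + b * v + b * b ^ m * w            ≡⟨ cong (_+ b * b ^ m * w) (value-suc (f ∘ (_↑ˡ l))) ⟨
  value (f ∘ (_↑ˡ l)) + b * b ^ m * w  ∎
  where
  open ≡-Reasoning
  x = toℕ (f zero)
  v = value (tail f ∘ (_↑ˡ l))
  w = value (tail f ∘ (m ↑ʳ_))
  shuffle : ∀ d b x p y → d + b * (x + p * y) ≡ d + b * x + b * p * y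
  shuffle = solve-∀

value-injective : (f g : Vector (Fin b) K) → value f ≡ value g → f ≗ g
value-injective {K = suc K} f g eq = λ where
    zero    → toℕ-injective (proj₁ parts)
    (suc j) → value-injective (tail f) (tail g) (proj₂ parts) j
  where
  parts = euclid-unique (toℕ<n (f zero)) (toℕ<n (g zero))
    (trans (sym (value-suc f)) (trans eq (value-suc g)))

-- A digit and its complement add up to `b - 1` at every place, so the values add up to the
-- `K`-digit number all of whose digits are `b - 1`. This lets `complement-balance` reflect a whole
-- walk at once.
value-opposite : (f : Vector (Fin b) K) → suc (value f + value (opposite ∘ f)) ≡ b ^ K
value-opposite {K = zero}  f = refl
value-opposite {b} {suc K} f = begin
  suc (value f + value (opposite ∘ f))
    ≡⟨ cong suc (cong₂ _+_ (value-suc f) (value-suc (opposite ∘ f))) ⟩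
  suc (x + b * v + (x̄ + b * v̄))
    ≡⟨ shuffle x x̄ b v v̄ ⟩
  suc (x + x̄) + b * (v + v̄)
    ≡⟨ cong (_+ b * (v + v̄)) (opposite-sum (f zero)) ⟩
  b + b * (v + v̄)
    ≡⟨ shuffle′ b (v + v̄) ⟩
  b * suc (v + v̄)
    ≡⟨ cong (b *_) (value-opposite (tail f)) ⟩
  b * b ^ K ∎
  where
  open ≡-Reasoning
  x = toℕ (f zero)
  x̄ = toℕ (opposite (f zero))
  v = value (tail f)
  v̄ = value (opposite ∘ tail f)
  shuffle : ∀ x x̄ b v v̄ → suc (x + b * v + (x̄ + b * v̄)) ≡ suc (x + x̄) + b * (v + v̄)
  shuffle = solve-∀
  shuffle′ : ∀ b w → b + b * w ≡ b * suc w
  shuffle′ = solve-∀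

-- Walks in the Hoey-Sloane graph

-- A walk from c to c′ with labels (f j , f′ j), all of its carries eliminated.
Walk : (c c′ : Fin n) (f f′ : Vector (Fin b) K) → Set
Walk {n} {b} {K} c c′ f f′ = n * value f′ + toℕ c ≡ b ^ K * toℕ c′ + value f

walk-cong : {c c′ : Fin n} {f f′ g g′ : Vector (Fin b) K} →
            f ≗ g → f′ ≗ g′ → Walk c c′ f f′ → Walk c c′ g g′
walk-cong {n} {b} {K} {c} {c′} f≗g f′≗g′ =
  subst₂ (λ v v′ → n * v′ + toℕ c ≡ b ^ K * toℕ c′ + v) (value-cong f≗g) (value-cong f′≗g′)

walk-reflect : {c c′ : Fin n} {f f′ : Vector (Fin b) K} → Walk c c′ f f′ →
               Walk (opposite c) (opposite c′) (opposite ∘ f) (opposite ∘ f′)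
walk-reflect {c = c} {c′} {f} {f′} =
  complement-balance (value-opposite f) (value-opposite f′) (opposite-sum c) (opposite-sum c′)

-- The second equation is scaled by `b ^ m` and added to the first; the carry `c₂`, leaving one half
-- and entering the other, cancels.
walk-join : ∀ m {l} {c₁ c₂ c₃ : Fin n} {f f′ : Vector (Fin b) (m + l)} →
            Walk c₁ c₂ (f ∘ (_↑ˡ l)) (f′ ∘ (_↑ˡ l)) → Walk c₂ c₃ (f ∘ (m ↑ʳ_)) (f′ ∘ (m ↑ʳ_)) →
            Walk c₁ c₃ f f′
walk-join {n} {b} m {l} {c₁} {c₂} {c₃} {f} {f′} w₁ w₂ = begin
  n * value f′ + toℕ c₁                            ≡⟨ cong (λ t → n * t + toℕ c₁) (value-split m f′) ⟩
  n * (x′ + b ^ m * y′) + toℕ c₁                   ≡⟨ shuffle₁ n x′ (b ^ m) y′ _ ⟩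
  n * x′ + toℕ c₁ + b ^ m * (n * y′)               ≡⟨ cong (_+ b ^ m * (n * y′)) w₁ ⟩
  b ^ m * toℕ c₂ + x + b ^ m * (n * y′)            ≡⟨ shuffle₂ (b ^ m) (toℕ c₂) x (n * y′) ⟩
  b ^ m * (n * y′ + toℕ c₂) + x                    ≡⟨ cong (λ t → b ^ m * t + x) w₂ ⟩
  b ^ m * (b ^ l * toℕ c₃ + y) + x                 ≡⟨ shuffle₃ (b ^ m) (b ^ l) (toℕ c₃) x y ⟩
  b ^ m * b ^ l * toℕ c₃ + (x + b ^ m * y)
    ≡⟨ cong₂ (λ s t → s * toℕ c₃ + t) (^-distribˡ-+-* b m l) (value-split m f) ⟨
  b ^ (m + l) * toℕ c₃ + value f                   ∎
  where
  open ≡-Reasoning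
  x  = value (f ∘ (_↑ˡ l))
  x′ = value (f′ ∘ (_↑ˡ l))
  y  = value (f ∘ (m ↑ʳ_))
  y′ = value (f′ ∘ (m ↑ʳ_))
  shuffle₁ : ∀ n x p y c → n * (x + p * y) + c ≡ n * x + c + p * (n * y)
  shuffle₁ = solve-∀
  shuffle₂ : ∀ p c x y → p * c + x + p * y ≡ p * (y + c) + x
  shuffle₂ = solve-∀
  shuffle₃ : ∀ p q c x y → p * (q * c + y) + x ≡ p * q * c + (x + p * y)
  shuffle₃ = solve-∀

empty-walk : {c : Fin n} {f f′ : Vector (Fin b) 0} → Walk c c f f′
empty-walk {n} {c = c} = trans (cong (_+ toℕ c) (*-zeroʳ n)) (shuffle (toℕ c))
  where
  shuffle : ∀ c → c ≡ 1 * c + 0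
  shuffle = solve-∀

walk-cons : {c₁ c₂ c₃ : Fin n} {f f′ : Vector (Fin b) (suc K)} →
            Transition c₁ c₂ (head f) (head f′) → Walk c₂ c₃ (tail f) (tail f′) → Walk c₁ c₃ f f′
walk-cons {n} {b} {K} {c₁ = c₁} {c₂} {c₃} {f} {f′} t w =
  walk-join 1 {f = f} {f′} (begin
    n * value (f′ ∘ (_↑ˡ K)) + toℕ c₁  ≡⟨ cong (λ v → n * v + toℕ c₁) (value-one (f′ ∘ (_↑ˡ K))) ⟩
    n * toℕ (f′ zero) + toℕ c₁         ≡⟨ t ⟩
    b * toℕ c₂ + toℕ (f zero)
      ≡⟨ cong₂ (λ p v → p * toℕ c₂ + v) (*-identityʳ b) (value-one (f ∘ (_↑ˡ K))) ⟨
    b * 1 * toℕ c₂ + value (f ∘ (_↑ˡ K)) ∎) w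
  where
  open ≡-Reasoning
  value-one : (g : Vector (Fin b) 1) → value g ≡ toℕ (g zero)
  value-one g = trans (+-identityʳ _) (*-identityʳ _)

-- The eliminated carry is recovered as in long multiplication: it is the quotient by `b` of `n`
-- times the lowest digit of `f′` plus the incoming carry.
walk-uncons : {c₁ c₃ : Fin n} {f f′ : Vector (Fin b) (suc K)} → Walk c₁ c₃ f f′ →
  ∃[ c₂ ] Transition c₁ c₂ (head f) (head f′) × Walk c₂ c₃ (tail f) (tail f′)
walk-uncons {n} {b@(suc _)} {K} {c₁} {c₃} {f} {f′} w = c₂ , step , rest
  where
  x  = toℕ (f zero)
  x′ = toℕ (f′ zero)
  v  = value (tail f)
  v′ = value (tail f′)
  y  = n * x′ + toℕ c₁

  -- The digit is at most `b - 1` and the carry at most `n - 1`, so the quotient of `y` by `b` is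
  -- again a state.
  bound : y < n * b
  bound = begin-strict
    n * x′ + toℕ c₁ <⟨ +-mono-≤-< (≤-refl {n * x′}) (toℕ<n c₁) ⟩
    n * x′ + n      ≡⟨ shuffle n x′ ⟩
    n * suc x′      ≤⟨ *-monoʳ-≤ n (toℕ<n (f′ zero)) ⟩
    n * b           ∎
    where
    open ≤-Reasoning
    shuffle : ∀ n x → n * x + n ≡ n * suc x
    shuffle = solve-∀

  c₂ : Fin n
  c₂ = fromℕ< (m<n*o⇒m/o<n bound)
  c₂≡ : toℕ c₂ ≡ y / b
  c₂≡ = toℕ-fromℕ< (m<n*o⇒m/o<n bound)

  open ≡-Reasoning

  -- Each side is a remainder below `b` plus a multiple of `b`. Equality of the remainders yields
  -- the transition, equality of the quotients the remaining walk.
  divided : y % b + b * (y / b + n * v′) ≡ x + b * (b ^ K * toℕ c₃ + v)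
  divided = begin
    y % b + b * (y / b + n * v′)              ≡⟨ shuffle₁ (y % b) b (y / b) (n * v′) ⟩
    y % b + y / b * b + b * (n * v′)          ≡⟨ cong (_+ b * (n * v′)) (m≡m%n+[m/n]*n y b) ⟨
    n * x′ + toℕ c₁ + b * (n * v′)            ≡⟨ shuffle₂ n x′ (toℕ c₁) b v′ ⟩
    n * (x′ + b * v′) + toℕ c₁                ≡⟨ cong (λ t → n * t + toℕ c₁) (value-suc f′) ⟨
    n * value f′ + toℕ c₁                     ≡⟨ w ⟩
    b * b ^ K * toℕ c₃ + value f              ≡⟨ cong (b * b ^ K * toℕ c₃ +_) (value-suc f) ⟩
    b * b ^ K * toℕ c₃ + (x + b * v)          ≡⟨ shuffle₃ b (b ^ K) (toℕ c₃) x v ⟩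
    x + b * (b ^ K * toℕ c₃ + v)              ∎
    where
    shuffle₁ : ∀ r b q z → r + b * (q + z) ≡ r + q * b + b * z
    shuffle₁ = solve-∀
    shuffle₂ : ∀ n x c b v → n * x + c + b * (n * v) ≡ n * (x + b * v) + c
    shuffle₂ = solve-∀
    shuffle₃ : ∀ b p c x v → b * p * c + (x + b * v) ≡ x + b * (p * c + v)
    shuffle₃ = solve-∀

  parts = euclid-unique (m%n<n y b) (toℕ<n (f zero)) divided

  step : Transition c₁ c₂ (f zero) (f′ zero)
  step = begin
    y                    ≡⟨ m≡m%n+[m/n]*n y b ⟩
    y % b + y / b * b    ≡⟨ cong₂ (λ r q → r + q * b) (proj₁ parts) (sym c₂≡) ⟩
    x + toℕ c₂ * b       ≡⟨ shuffle x (toℕ c₂) b ⟩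
    b * toℕ c₂ + x       ∎
    where
    shuffle : ∀ x c b → x + c * b ≡ b * c + x
    shuffle = solve-∀

  rest : Walk c₂ c₃ (tail f) (tail f′)
  rest = begin
    n * v′ + toℕ c₂      ≡⟨ +-comm (n * v′) _ ⟩
    toℕ c₂ + n * v′      ≡⟨ cong (_+ n * v′) c₂≡ ⟩
    y / b + n * v′       ≡⟨ proj₂ parts ⟩
    b ^ K * toℕ c₃ + v   ∎
walk-uncons {b = zero} {f = f} w with () ← f zero

-- The halves are segments of one string, so that a closed walk at `t` can be inserted at the cut.
-- Either segment may be empty: the ends of a walk count as visited.
data Through (c t c′ : Fin n) : ∀ {K} → (f f′ : Vector (Fin b) K) → Set where
  through : ∀ {m l} {f f′ : Vector (Fin b) (m + l)} →
            Walk c t (f ∘ (_↑ˡ l)) (f′ ∘ (_↑ˡ l)) → Walk t c′ (f ∘ (m ↑ʳ_)) (f′ ∘ (m ↑ʳ_)) →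
            Through c t c′ f f′

through-cons : {c₁ c₂ t c′ : Fin n} {f f′ : Vector (Fin b) (suc K)} →
  Transition c₁ c₂ (head f) (head f′) → Through c₂ t c′ (tail f) (tail f′) → Through c₁ t c′ f f′
through-cons {f = f} {f′} s (through {m = m} {l} w₁ w₂) =
  through {m = suc m} {l} {f} {f′} (walk-cons {f = f ∘ (_↑ˡ l)} {f′ ∘ (_↑ˡ l)} s w₁) w₂

through-source : {c c′ : Fin n} {f f′ : Vector (Fin b) K} → Walk c c′ f f′ → Through c c c′ f f′
through-source {f = f} {f′} w = through {m = 0} {f = f} {f′} (empty-walk {f = f ∘ (_↑ˡ _)} {f′ ∘ (_↑ˡ _)}) w

-- The walk equation mentions only the two ends. Peeling off digits exposes the transition at
-- position `j` and cuts the walk at both of its states.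
walk-step : {c c′ : Fin n} {f f′ : Vector (Fin b) K} → Walk c c′ f f′ → ∀ j →
  ∃[ c₁ ] ∃[ c₂ ] Transition c₁ c₂ (f j) (f′ j) × Through c c₁ c′ f f′ × Through c c₂ c′ f f′
walk-step {K = suc K} {c} {f = f} {f′} w zero with c₂ , s , w′ ← walk-uncons {f = f} {f′} w =
  c , c₂ , s , through-source w , through-cons s (through-source w′)
walk-step {K = suc K} {f = f} {f′} w (suc j)
  with _ , s , w′ ← walk-uncons {f = f} {f′} w
  with c₁ , c₂ , s′ , t₁ , t₂ ← walk-step {f = tail f} {tail f′} w′ j =
  c₁ , c₂ , s′ , through-cons s t₁ , through-cons s t₂

-- Permutiples as closed walks at the state 0

permutiple⇒walk : {d : Vector (Fin b) K} (σ : Permutation′ K) → IsPermutiple (suc n) d σ →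
                  Walk {suc n} zero zero d (d ∘ (σ ⟨$⟩ʳ_))
permutiple⇒walk {b} {K} {d = d} σ p =
  trans (+-identityʳ _) (trans (sym p) (sym (cong (_+ value d) (*-zeroʳ (b ^ K)))))

walk⇒permutiple : {d : Vector (Fin b) K} (σ : Permutation′ K) →
                  Walk {suc n} zero zero d (d ∘ (σ ⟨$⟩ʳ_)) → IsPermutiple (suc n) d σ
walk⇒permutiple {b} {K} {d = d} σ w =
  trans (sym (cong (_+ value d) (*-zeroʳ (b ^ K)))) (trans (sym w) (+-identityʳ _))

-- Positions of A·W·B, where A·B is a walk of length m + l split at m.
splice : ∀ m l k → Fin (m + (k + l)) ↔ (Fin (m + l) ⊎ Fin k)
splice m l k =
  (↔-sym (+↔⊎ {m} {l}) ⊎-↔ ↔-id (Fin k)) ↔-∘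
  (regroup ↔-∘ ((↔-id (Fin m) ⊎-↔ +↔⊎ {k} {l}) ↔-∘ +↔⊎ {m} {k + l}))
  where
  regroup : ∀ {A B C : Set} → (A ⊎ (C ⊎ B)) ↔ ((A ⊎ B) ⊎ C)
  regroup = mk↔ₛ′
    (λ { (inj₁ a) → inj₁ (inj₁ a) ; (inj₂ (inj₁ c)) → inj₂ c ; (inj₂ (inj₂ b)) → inj₁ (inj₂ b) })
    (λ { (inj₁ (inj₁ a)) → inj₁ a ; (inj₁ (inj₂ b)) → inj₂ (inj₂ b) ; (inj₂ c) → inj₂ (inj₁ c) })
    (λ { (inj₁ (inj₁ a)) → refl ; (inj₁ (inj₂ b)) → refl ; (inj₂ c) → refl })
    (λ { (inj₁ a) → refl ; (inj₂ (inj₁ c)) → refl ; (inj₂ (inj₂ b)) → refl })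

spliced : ∀ m l {k} → Vector (Fin b) (m + l) → Vector (Fin b) k → Vector (Fin b) (m + (k + l))
spliced m l f g = [ f , g ] ∘ Inverse.to (splice m l _)

walk-splice : ∀ m l {k} {c t c′ : Fin n} {f f′ : Vector (Fin b) (m + l)} {g g′ : Vector (Fin b) k} →
  Walk c t (f ∘ (_↑ˡ l)) (f′ ∘ (_↑ˡ l)) → Walk t c′ (f ∘ (m ↑ʳ_)) (f′ ∘ (m ↑ʳ_)) → Walk t t g g′ →
  Walk c c′ (spliced m l f g) (spliced m l f′ g′)
walk-splice m l {k} {f = f} {f′} {g} {g′} before after inserted =
  walk-join m {f = h} {h′} (walk-cong (at-before f g) (at-before f′ g′) before)
    (walk-join k {f = h ∘ (m ↑ʳ_)} {h′ ∘ (m ↑ʳ_)}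
      (walk-cong (at-inserted f g) (at-inserted f′ g′) inserted)
      (walk-cong (at-after f g) (at-after f′ g′) after))
  where
  h  = spliced m l f g
  h′ = spliced m l f′ g′
  -- `spliced` reduces only once `splitAt` has located the position, so the segments agree with
  -- their sources pointwise and not by definition.
  at-before : ∀ f g → f ∘ (_↑ˡ l) ≗ spliced m l f g ∘ (_↑ˡ (k + l))
  at-before f g i rewrite splitAt-↑ˡ m i (k + l) = refl
  at-inserted : ∀ f g → g ≗ spliced m l f g ∘ (m ↑ʳ_) ∘ (_↑ˡ l)
  at-inserted f g i rewrite splitAt-↑ʳ m (k + l) (i ↑ˡ l) | splitAt-↑ˡ k i l = refl
  at-after : ∀ f g → f ∘ (m ↑ʳ_) ≗ spliced m l f g ∘ (m ↑ʳ_) ∘ (k ↑ʳ_)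
  at-after f g i rewrite splitAt-↑ʳ m (k + l) (k ↑ʳ i) | splitAt-↑ʳ k l i = refl

-- `opposite zero` is the top state. Since the walk of `d` is closed at `zero`, its reflection is
-- closed at the top state and fits into the cut. The original positions contribute `P`, the
-- inserted ones `reflect P`.
symmetrized : {d : Vector (Fin b) K} (σ : Permutation′ K) →
  Through {suc n} zero (opposite zero) zero d (d ∘ (σ ⟨$⟩ʳ_)) →
  let P = permutipleGraph d σ in
  ∃[ L ] Σ[ e ∈ Vector (Fin b) L ] Σ[ τ ∈ Permutation′ L ]
    IsPermutiple (suc n) e τ × permutipleGraph e τ ⇔ (P ∪ reflect P)
symmetrized {b} {n = n} {d} σ (through {m = m} {l} w₁ w₂) =
  _ , e , τ , walk⇒permutiple {n = n} {e} τ e-walk , to , from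
  where
  k = m + l
  φ = splice m l k
  d′ = d ∘ (σ ⟨$⟩ʳ_)
  e = spliced m l d (opposite ∘ d)
  -- `τ` acts as `σ` on each of the two copies of the positions.
  τ : Permutation′ (m + (k + l))
  τ = ↔-sym φ ↔-∘ ((σ ⊎-↔ σ) ↔-∘ φ)

  w̄ : Walk {suc n} (opposite zero) (opposite zero) (opposite ∘ d) (opposite ∘ d′)
  w̄ = walk-reflect {f = d} {d′} (walk-join m {f = d} {d′} w₁ w₂)

  digit′ : ∀ x → [ d′ , opposite ∘ d′ ] x ≡ [ d , opposite ∘ d ] (Inverse.to (σ ⊎-↔ σ) x)
  digit′ (inj₁ _) = refl
  digit′ (inj₂ _) = refl

  -- Splicing the right-hand digits agrees with permuting `e`: the `φ` inside `e` cancels the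
  -- inverse of `φ` that ends `τ`.
  e∘τ : spliced m l d′ (opposite ∘ d′) ≗ e ∘ (τ ⟨$⟩ʳ_)
  e∘τ i = trans (digit′ (Inverse.to φ i))
    (cong [ d , opposite ∘ d ] (sym (Inverse.strictlyInverseˡ φ (Inverse.to (σ ⊎-↔ σ) (Inverse.to φ i)))))

  e-walk : Walk {suc n} zero zero e (e ∘ (τ ⟨$⟩ʳ_))
  e-walk = walk-cong {suc n} {f = e} (λ _ → refl) e∘τ
    (walk-splice m l {f = d} {d′} {opposite ∘ d} {opposite ∘ d′} w₁ w₂ w̄)

  P = permutipleGraph d σ

  edge-at : ∀ x → (P ∪ reflect P) ([ d , opposite ∘ d ] x) ([ d′ , opposite ∘ d′ ] x)
  edge-at (inj₁ j) = inj₁ (j , refl , refl)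
  edge-at (inj₂ j) = inj₂ (j , opposite-involutive _ , opposite-involutive _)

  to : permutipleGraph e τ ⇒ (P ∪ reflect P)
  to (i , refl , refl) = subst ((P ∪ reflect P) _) (e∘τ i) (edge-at (Inverse.to φ i))

  edge-of : ∀ x → permutipleGraph e τ ([ d , opposite ∘ d ] x) ([ d′ , opposite ∘ d′ ] x)
  edge-of x = Inverse.from φ x , cong [ d , opposite ∘ d ] (sym x≡)
            , trans (cong [ d′ , opposite ∘ d′ ] (sym x≡)) (e∘τ _)
    where x≡ = Inverse.strictlyInverseˡ φ x

  from : (P ∪ reflect P) ⇒ permutipleGraph e τ
  from (inj₁ (j , refl , refl)) = edge-of (inj₁ j)
  from (inj₂ (j , x≡ , y≡)) =
    subst₂ (permutipleGraph e τ) (sym (opposite-flip x≡)) (sym (opposite-flip y≡)) (edge-of (inj₂ j))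

-- After the nonzero multiplier is cancelled, the two rearrangements have equal value and equal
-- length, hence equal digits, even where `σ` and `τ` differ.
permutipleGraph-unique : {d : Vector (Fin b) K} (σ τ : Permutation′ K) →
  IsPermutiple (suc n) d σ → IsPermutiple (suc n) d τ → permutipleGraph d σ ⇒ permutipleGraph d τ
permutipleGraph-unique {n = n} {d} σ τ p q (j , x≡ , y≡) = j , x≡ , trans y≡
  (value-injective (d ∘ (σ ⟨$⟩ʳ_)) (d ∘ (τ ⟨$⟩ʳ_)) (*-cancelˡ-≡ _ _ (suc n) (trans (sym p) q)) j)

-- Cycles

record SimplePath (G : Graph b) (x y : Fin b) : Set where
  constructor simplePath
  field
    {ℓ}      : ℕ
    node     : Fin (suc ℓ) → Fin b
    distinct : ∀ {i j} → node i ≡ node j → i ≡ j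
    step     : ∀ i → G (node (inject₁ i)) (node (suc i))
    starts   : node zero ≡ x
    ends     : node (fromℕ ℓ) ≡ y

path-suffix : {x y : Fin b} (P : SimplePath G x y) → ∀ i → SimplePath G (SimplePath.node P i) y
path-suffix P zero = record { SimplePath P ; starts = refl }
path-suffix (simplePath {suc ℓ} node distinct step _ ends) (suc i) =
  path-suffix (simplePath (node ∘ suc) (suc-injective ∘ distinct) (step ∘ suc) refl ends) i

-- A path that returns to x is cut there, so no vertex repeats.
path-cons : {x y z : Fin b} → G x y → SimplePath G y z → SimplePath G x z
path-cons {G = G} {x} {y} {z} e P@(simplePath node distinct step starts ends)
  with any? (λ i → node i ≟ x)
... | yes (i , refl) = path-suffix P i
... | no  x∉P        = simplePath (x ∷ node) distinct′ step′ refl ends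
  where
  distinct′ : ∀ {i j} → (x ∷ node) i ≡ (x ∷ node) j → i ≡ j
  distinct′ {zero}  {zero}  _  = refl
  distinct′ {zero}  {suc j} eq = contradiction (j , sym eq) x∉P
  distinct′ {suc i} {zero}  eq = contradiction (i , eq) x∉P
  distinct′ {suc i} {suc j} eq = cong suc (distinct eq)
  step′ : ∀ i → G ((x ∷ node) (inject₁ i)) ((x ∷ node) (suc i))
  step′ zero    = subst (G x) (sym starts) e
  step′ (suc i) = step i

cyclicSuc-fromℕ : ∀ m → cyclicSuc (fromℕ m) ≡ zero
cyclicSuc-fromℕ m = toℕ-injective (begin
  toℕ (cyclicSuc (fromℕ m))       ≡⟨ toℕ-fromℕ< (m%n<n (suc (toℕ (fromℕ m))) (suc m)) ⟩
  suc (toℕ (fromℕ m)) % suc m     ≡⟨ cong (λ t → suc t % suc m) (toℕ-fromℕ m) ⟩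
  suc m % suc m                   ≡⟨ n%n≡0 (suc m) ⟩
  0                               ∎)
  where open ≡-Reasoning

cyclicSuc-inject₁ : ∀ {m} (i : Fin m) → cyclicSuc (inject₁ i) ≡ suc i
cyclicSuc-inject₁ {m} i = toℕ-injective (begin
  toℕ (cyclicSuc (inject₁ i))     ≡⟨ toℕ-fromℕ< (m%n<n (suc (toℕ (inject₁ i))) (suc m)) ⟩
  suc (toℕ (inject₁ i)) % suc m   ≡⟨ cong (λ t → suc t % suc m) (toℕ-inject₁ i) ⟩
  suc (toℕ i) % suc m             ≡⟨ m<n⇒m%n≡m (s≤s (toℕ<n i)) ⟩
  suc (toℕ i)                     ∎)
  where open ≡-Reasoning

-- The edge from `x` to `y` becomes the wrap-around step, from the last node to node zero. A
-- one-vertex path closes up to a loop.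
path⇒cycle : {x y : Fin b} → G x y → SimplePath G y x → Σ[ Z ∈ DirectedCycle G ] cycleEdges Z x y
path⇒cycle {G = G} {x} {y} e (simplePath {ℓ} node distinct step starts ends) =
  record { node = node ; distinct = distinct ; step = cyclic-step } ,
  fromℕ ℓ , sym ends , trans (sym starts) (cong node (sym (cyclicSuc-fromℕ ℓ)))
  where
  cyclic-step : ∀ i → G (node i) (node (cyclicSuc i))
  cyclic-step i with view i
  ... | ‵fromℕ     = subst₂ G (sym ends) (trans (sym starts) (cong node (sym (cyclicSuc-fromℕ ℓ)))) e
  ... | ‵inject₁ j = subst (G _) (cong node (sym (cyclicSuc-inject₁ j))) (step j)

cycleEdges⇒ : (Z : DirectedCycle G) → cycleEdges Z ⇒ G
cycleEdges⇒ Z (i , refl , refl) = DirectedCycle.step Z i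

-- Orbits of a permutation

module _ (σ : Permutation′ K) where

  private
    orbit : Fin K → ℕ → Fin K
    orbit = iterate (σ ⟨$⟩ʳ_)

  orbit-+ : ∀ m o i → orbit i (m + o) ≡ orbit (orbit i o) m
  orbit-+ zero    o i = refl
  -- `iterate` applies `σ` to its starting point first, so one application has to be moved past the
  -- other `o`.
  orbit-+ (suc m) o i = trans (orbit-+ m o (σ ⟨$⟩ʳ i)) (cong (λ i → orbit i m) (orbit-suc o i))
    where
    orbit-suc : ∀ o i → orbit (σ ⟨$⟩ʳ i) o ≡ σ ⟨$⟩ʳ orbit i o
    orbit-suc zero    i = refl
    orbit-suc (suc o) i = orbit-suc o (σ ⟨$⟩ʳ i)

  orbit-injective : ∀ m {i j} → orbit i m ≡ orbit j m → i ≡ j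
  orbit-injective zero    eq = eq
  orbit-injective (suc m) eq = Injection.injective (↔⇒↣ σ) (orbit-injective m eq)

  -- Two of the first `K + 1` iterates coincide, at `r < s`, and injectivity removes `r`
  -- applications from both. As `s` is `r + suc o`, `o` applications lead from the image of `i` back
  -- to `i`.
  orbit-returns : ∀ i → ∃[ m ] orbit (σ ⟨$⟩ʳ i) m ≡ i
  orbit-returns i
    with r , s , r<s , eq ← pigeonhole (n<1+n K) (orbit i ∘ toℕ)
    with o , r+o≡s ← m≤n⇒∃[o]m+o≡n r<s =
    o , sym (orbit-injective (toℕ r) (begin
      orbit i (toℕ r)                      ≡⟨ eq ⟩
      orbit i (toℕ s)                      ≡⟨ cong (orbit i) (trans (+-suc (toℕ r) o) r+o≡s) ⟨
      orbit i (toℕ r + suc o)              ≡⟨ orbit-+ (toℕ r) (suc o) i ⟩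
      orbit (orbit (σ ⟨$⟩ʳ i) o) (toℕ r)   ∎))
    where open ≡-Reasoning

  -- Distinct positions can hold equal digits, so the digits along an orbit may repeat before it
  -- closes up; `path-cons` cuts the repetitions out.
  orbit-path : (d : Vector (Fin b) K) → ∀ m i → SimplePath (permutipleGraph d σ) (d i) (d (orbit i m))
  orbit-path d zero i =
    simplePath {ℓ = 0} (λ _ → d i) (λ { {zero} {zero} _ → refl }) (λ ()) refl refl
  orbit-path d (suc m) i = path-cons (i , refl , refl) (orbit-path d m (σ ⟨$⟩ʳ i))

  permutiple-edge-on-cycle : (d : Vector (Fin b) K) {x y : Fin b} → permutipleGraph d σ x y →
    Σ[ Z ∈ DirectedCycle (permutipleGraph d σ) ] cycleEdges Z x y
  permutiple-edge-on-cycle d (i , refl , refl) with m , eq ← orbit-returns i =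
    path⇒cycle (i , refl , refl)
      (subst (SimplePath (permutipleGraph d σ) _) (cong d eq) (orbit-path d m (σ ⟨$⟩ʳ i)))

-- Classes

Cl-mono : G ⇒ H → ∀ {q} → Cl n G q → Cl n H q
Cl-mono G⇒H (σ , p , P⇒G) = σ , p , λ e → G⇒H (P⇒G e)

module _ {C : Pred (DigitString b) 0ℓ} {G : Graph b} (isClass : IsPermutipleClass n C G) where

  open IsPermutipleClass isClass

  class≐Cl : C ≐ Cl n G
  class≐Cl = (λ q∈C → Cl-mono {n = n} (proj₁ graph) (proj₁ members q∈C))
           , (λ q∈Cl → proj₂ members (Cl-mono {n = n} (proj₂ graph) q∈Cl))

module _ {C : Pred (DigitString b) 0ℓ} {G : Graph b} (isClass : IsPermutipleClass (suc n) C G) where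

  open IsPermutipleClass isClass

  -- The generator `digits` is itself a member of `C`. Whichever permutation puts it into
  -- `Cl (suc n) H` yields the same graph, so that graph lies in `H`.
  class-graph-minimal : (∀ {q} → C q → Cl (suc n) H q) → G ⇒ H
  class-graph-minimal C⊆ClH e with τ , q , Q⇒H ← C⊆ClH (proj₂ members (σ , isPermutiple , id)) =
    Q⇒H (permutipleGraph-unique {n = n} {digits} σ τ isPermutiple q (proj₂ graph e))

module _ (n<b : suc n < b) {C : Pred (DigitString b) 0ℓ} {G : Graph b}
         (isClass : IsPermutipleClass (suc n) C G) where

  open IsPermutipleClass isClass

  private
    Passes : Fin (suc n) → Set
    Passes c = Through zero c zero digits (digits ∘ (σ ⟨$⟩ʳ_))

  class-transition : ∀ {x y} → G x y → ∃[ c₁ ] ∃[ c₂ ] Transition c₁ c₂ x y × Passes c₁ × Passes c₂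
  class-transition e with j , refl , refl ← proj₂ graph e =
    walk-step (permutiple⇒walk {n = n} {digits} σ isPermutiple) j

  class⇒mother : G ⇒ mother (suc n) b
  class⇒mother e with _ , _ , t , _ ← class-transition e = transition⇒mother n<b t

  class-edge-on-cycle : ∀ {x y} → G x y →
    Σ[ Z ∈ DirectedCycle (mother (suc n) b) ] cycleEdges Z ⇒ G × cycleEdges Z x y
  class-edge-on-cycle e with Z , e∈Z ← permutiple-edge-on-cycle σ digits (proj₂ graph e) =
    -- The nodes are kept; the steps lie in `G` and therefore in the mother graph, where `Γ` takes
    -- its cycles.
    record { node = node ; distinct = distinct ; step = λ i → class⇒mother (proj₁ graph (step i)) } ,
    (λ z → proj₁ graph (cycleEdges⇒ Z z)) , e∈Z
    where open DirectedCycle Z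

  class-edge-label : ∀ {x y} → G x y → ∃[ c₁ ] ∃[ c₂ ] label (Γ (suc n) G) c₁ c₂ x y
  class-edge-label e
    with c₁ , c₂ , t , _ ← class-transition e
    with Z , Z⇒G , e∈Z ← class-edge-on-cycle e = c₁ , c₂ , Z , Z⇒G , e∈Z , t

  -- A state of `Γ` is an end of a transition labelled by an edge of `G`. The walk of `digits` has a
  -- transition with the same label, and `transition-unique` identifies their ends. Thus the top
  -- state of `Γ` is a state that the walk really visits.
  class-visits : ∀ {c} → vertex (Γ (suc n) G) c → Passes c
  class-visits (Z , Z⇒G , _ , inj₁ (_ , d₂ , e , t))
    with _ , _ , t′ , p , _ ← class-transition (Z⇒G e) =
    subst Passes (sym (proj₁ (transition-unique (<⇒≤ n<b) {d₂ = d₂} t t′))) p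
  class-visits (Z , Z⇒G , _ , inj₂ (_ , d₂ , e , t))
    with _ , _ , t′ , _ , p ← class-transition (Z⇒G e) =
    subst Passes (sym (proj₂ (transition-unique (<⇒≤ n<b) {d₂ = d₂} t t′))) p

  symmetricClosure-isClass : HasTopState (Γ (suc n) G) →
    IsPermutipleClass (suc n) (Cl (suc n) (G ∪ reflect G)) (G ∪ reflect G)
  symmetricClosure-isClass (c , c≡n , visited)
    with symmetrized {d = digits} σ (subst Passes c≡top (class-visits visited))
    where
    c≡top : c ≡ opposite zero
    c≡top = toℕ-injective (trans c≡n (sym (toℕ-fromℕ n)))
  -- A class needs a nonempty generator: the edge of `digits` at position `zero` would have to occur
  -- in the empty string `e`.
  ... | zero  , e , τ , p , P⇔P̂ with () ← proj₁ (proj₂ P⇔P̂ (inj₁ (zero , refl , refl)))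
  ... | suc L , e , τ , p , P⇔P̂ = record
    { digits       = e
    ; σ            = τ
    ; isPermutiple = p
    ; graph        = to , from
    ; members      = Cl-mono {n = suc n} from , Cl-mono {n = suc n} to
    }
    where
    to : permutipleGraph e τ ⇒ (G ∪ reflect G)
    to x = [ (λ y → inj₁ (proj₁ graph y)) , (λ y → inj₂ (proj₁ graph y)) ] (proj₁ P⇔P̂ x)
    from : (G ∪ reflect G) ⇒ permutipleGraph e τ
    from = [ (λ y → proj₂ P⇔P̂ (inj₁ (proj₂ graph y))) , (λ y → proj₂ P⇔P̂ (inj₂ (proj₂ graph y))) ]

-- Symmetry of G and of Γ

-- Reflection is an involution, so reflecting one inclusion gives the other.
symmetric-graph : reflect G ⇒ G → IsSymmetricGraph G
symmetric-graph {G = G} Ḡ⇒G = Ḡ⇒G , λ {x} {y} e →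
  Ḡ⇒G (subst₂ G (sym (opposite-involutive x)) (sym (opposite-involutive y)) e)

Γ-mono : G ⇒ H → Γ n G ⊑ Γ n H
Γ-mono G⇒H = (λ (Z , Z⇒G , v) → Z , (λ z → G⇒H (Z⇒G z)) , v)
           , (λ (Z , Z⇒G , v) → Z , (λ z → G⇒H (Z⇒G z)) , v)
           , (λ (Z , Z⇒G , v) → Z , (λ z → G⇒H (Z⇒G z)) , v)

⊑-reflect⇒reflect-⊑ : {J : LabelledGraph n b} → J ⊑ reflectLabelled J → reflectLabelled J ⊑ J
⊑-reflect⇒reflect-⊑ {J = J} (v , e , l) =
  (λ {c} x → subst (vertex J) (opposite-involutive c) (v x)) ,
  (λ {c₁} {c₂} x → subst₂ (edge J) (opposite-involutive c₁) (opposite-involutive c₂) (e x)) ,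
  (λ {c₁} {c₂} {d₁} {d₂} x →
    subst₂ (label J c₁ c₂) (opposite-involutive d₁) (opposite-involutive d₂)
      (subst₂ (λ c₁ c₂ → label J c₁ c₂ _ _) (opposite-involutive c₁) (opposite-involutive c₂) (l x)))

module _ (G⇒M : G ⇒ mother n b) (G⇒Ḡ : G ⇒ reflect G) where

  reflectCycle : (Z : DirectedCycle (mother n b)) → cycleEdges Z ⇒ G →
    Σ[ Z̄ ∈ DirectedCycle (mother n b) ] cycleEdges Z̄ ⇒ G × (cycleEdges Z ⇒ reflect (cycleEdges Z̄))
  reflectCycle Z Z⇒G =
    record
      { node     = opposite ∘ node
      ; distinct = λ eq → distinct (trans (opposite-flip eq) (opposite-involutive _))
      ; step     = λ i → G⇒M (G⇒Ḡ (Z⇒G (i , refl , refl)))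
      } ,
    (λ { (i , refl , refl) → G⇒Ḡ (Z⇒G (i , refl , refl)) }) ,
    (λ (i , x≡ , y≡) → i , cong opposite x≡ , cong opposite y≡)
    where open DirectedCycle Z

  -- `reflectCycle` supplies a cycle through the complementary digits, and `transition-reflect`
  -- carries each of its labels to the complementary states.
  Γ⊑reflect : Γ n G ⊑ reflectLabelled (Γ n G)
  Γ⊑reflect =
    (λ {c} (Z , Z⇒G , c′ , x) → let Z̄ , Z̄⇒G , r = reflectCycle Z Z⇒G in
      Z̄ , Z̄⇒G , opposite c′ ,
      [ (λ (d₁ , d₂ , e , t) → inj₁ (opposite d₁ , opposite d₂ , r e , transition-reflect c c′ d₁ d₂ t))
      , (λ (d₁ , d₂ , e , t) → inj₂ (opposite d₁ , opposite d₂ , r e , transition-reflect c′ c d₁ d₂ t)) ] x) ,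
    (λ {c₁} {c₂} (Z , Z⇒G , d₁ , d₂ , e , t) → let Z̄ , Z̄⇒G , r = reflectCycle Z Z⇒G in
      Z̄ , Z̄⇒G , opposite d₁ , opposite d₂ , r e , transition-reflect c₁ c₂ d₁ d₂ t) ,
    (λ {c₁} {c₂} {d₁} {d₂} (Z , Z⇒G , e , t) → let Z̄ , Z̄⇒G , r = reflectCycle Z Z⇒G in
      Z̄ , Z̄⇒G , r e , transition-reflect c₁ c₂ d₁ d₂ t)

Γ⊑hoeySloane : Γ n G ⊑ hoeySloane n b
Γ⊑hoeySloane =
  (λ _ → tt) ,
  (λ (Z , _ , d₁ , d₂ , e , t) → d₁ , d₂ , cycleEdges⇒ Z e , t) ,
  (λ (Z , _ , e , t) → cycleEdges⇒ Z e , t)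

theorem18 :
    (n b : ℕ) → 1 < n → n < b →
    (C : Pred (DigitString b) 0ℓ) (G : Graph b) →
    IsPermutipleClass n C G →
    HasTopState (Γ n G) →
    let Ĝ = G ∪ reflect G
        Ĉ = Cl n Ĝ
    in
    IsSymmetricClass n Ĉ Ĝ
    × (IsSymmetricClass n C G iff (C ≐ Ĉ))
    × ((C ≐ Ĉ) iff IsSymmetricSubgraph (Γ n G))
    × (IsSymmetricSubgraph (Γ n G) iff IsSymmetricGraph G)
theorem18 n@(suc _) b _ n<b C G isClass topState =
  Ĉ-symmetric ,
  mk⇔ (λ C-sym → symmetric⇒closed (symmetricClass⇒ C-sym)) (λ eq → symmetricClass (closed⇒symmetric eq)) ,
  mk⇔ (λ eq → Γ-symmetric (closed⇒symmetric eq)) (λ Γ-sym → symmetric⇒closed (Γ-symmetric⇒ Γ-sym)) ,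
  mk⇔ (λ Γ-sym → symmetric-graph (Γ-symmetric⇒ Γ-sym)) (λ G-sym → Γ-symmetric (proj₁ G-sym))
  where
  Ĝ : Graph b
  Ĝ = G ∪ reflect G

  C≐ClG : C ≐ Cl n G
  C≐ClG = class≐Cl isClass

  reflect⇒Ĝ : reflect Ĝ ⇒ Ĝ
  reflect⇒Ĝ (inj₁ e) = inj₂ e
  reflect⇒Ĝ (inj₂ e) = inj₁ (reflect-reflect G e)

  Ĉ-isClass : IsPermutipleClass n (Cl n Ĝ) Ĝ
  Ĉ-isClass = symmetricClosure-isClass n<b isClass topState

  Ĉ-symmetric : IsSymmetricClass n (Cl n Ĝ) Ĝ
  Ĉ-symmetric = record
    { isClass      = Ĉ-isClass
    ; topState     = let c , c≡ , v = topState in c , c≡ , proj₁ (Γ-mono inj₁) v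
    ; ≐-reflection = Cl-mono {n = n} (proj₂ (symmetric-graph {G = Ĝ} reflect⇒Ĝ)) , Cl-mono {n = n} reflect⇒Ĝ
    }

  symmetricClass⇒ : IsSymmetricClass n C G → reflect G ⇒ G
  -- Minimality gives `G ⇒ reflect G`; applied to a reflected edge, this is the wanted inclusion up
  -- to a double complement.
  symmetricClass⇒ C-sym e = reflect-reflect G
    (class-graph-minimal isClass (proj₁ (IsSymmetricClass.≐-reflection C-sym)) e)

  symmetricClass : reflect G ⇒ G → IsSymmetricClass n C G
  symmetricClass Ḡ⇒G = record
    { isClass      = isClass
    ; topState     = topState
    ; ≐-reflection = (λ q → Cl-mono {n = n} (proj₂ (symmetric-graph {G = G} Ḡ⇒G)) (proj₁ C≐ClG q))
                   , (λ q → proj₂ C≐ClG (Cl-mono {n = n} Ḡ⇒G q))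
    }

  symmetric⇒closed : reflect G ⇒ G → C ≐ Cl n Ĝ
  symmetric⇒closed Ḡ⇒G = (λ q → Cl-mono {n = n} inj₁ (proj₁ C≐ClG q))
                       , (λ q → proj₂ C≐ClG (Cl-mono {n = n} [ id , Ḡ⇒G ] q))

  closed⇒symmetric : C ≐ Cl n Ĝ → reflect G ⇒ G
  closed⇒symmetric (_ , Ĉ⊆C) e =
    -- Minimality is applied to the closure, whose generator is the spliced permutiple: all of `Ĝ`
    -- lies in `G`, in particular `reflect G`.
    class-graph-minimal Ĉ-isClass (λ q → proj₁ C≐ClG (Ĉ⊆C q)) (inj₂ e)

  Γ-symmetric : reflect G ⇒ G → IsSymmetricSubgraph (Γ n G)
  Γ-symmetric Ḡ⇒G = Γ⊑hoeySloane , ⊑-reflect⇒reflect-⊑ Γ⊑Γ̄ , Γ⊑Γ̄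
    where Γ⊑Γ̄ = Γ⊑reflect (class⇒mother n<b isClass) (proj₂ (symmetric-graph {G = G} Ḡ⇒G))

  Γ-symmetric⇒ : IsSymmetricSubgraph (Γ n G) → reflect G ⇒ G
  -- `l` sends labels of `Γ` to labels of its reflection. The edge `e` is a label, so its complement
  -- is one too and lies on a cycle inside `G`.
  Γ-symmetric⇒ (_ , _ , _ , _ , l) e
    with _ , _ , x ← class-edge-label n<b isClass e
    with Z , Z⇒G , z , _ ← l x = reflect-reflect G (Z⇒G z)
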